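{- Let $\mathsf{CL}_{\rm b}:=\mathsf{ILL}_\bot+\mathsf{PRO}+\mathsf{DNE}$ and let $A\mapsto A^\dagger$ be the translation of formulas of first-order classical logic $\mathsf{CL}$ into formulas of $\mathsf{ILL}_\bot$ defined in the context. Then for every formula $A$ of $\mathsf{CL}$: $\vdash_{\mathsf{CL}}A$ if and only if $\vdash_{\mathsf{CL}_{\rm b}}A^\dagger$.
   Context: Intuitionistic linear logic $\mathsf{ILL}$ (first order). Formulas are built from atomic formulas, including the constants $1,\top,0$, using $\otimes,\&,\oplus,\multimap$, $\forall x,\exists x$ and $!$. Sequents are $\Gamma\vdash A$ with $\Gamma$ a finite multiset of formulas and exactly one formula on the right. Axioms: $A\vdash A$; $\vdash 1$; $\Gamma\vdash\top$; $\Gamma,0\vdash C$. Rules (premises $\Rightarrow$ conclusion): (cut) $\Gamma\vdash A;\ \Delta,A\vdash C\Rightarrow\Gamma,\Delta\vdash C$; $\Gamma\vdash C\Rightarrow\Gamma,1\vdash C$; $\Gamma\vdash A;\ \Delta\vdash B\Rightarrow\Gamma,\Delta\vdash A\otimes B$; $\Gamma,A,B\vdash C\Rightarrow\Gamma,A\otimes B\vdash C$; $\Gamma,A\vdash B\Rightarrow\Gamma\vdash A\multimap B$; $\Gamma\vdash A;\ \Delta,B\vdash C\Rightarrow\Gamma,\Delta,A\multimap B\vdash C$; $\Gamma\vdash A;\ \Gamma\vdash B\Rightarrow\Gamma\vdash A\& B$; $\Gamma,A\vdash C\Rightarrow\Gamma,A\& B\vdash C$; $\Gamma,B\vdash C\Rightarrow\Gamma,A\&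 B\vdash C$; $\Gamma\vdash A\Rightarrow\Gamma\vdash A\oplus B$; $\Gamma\vdash B\Rightarrow\Gamma\vdash A\oplus B$; $\Gamma,A\vdash C;\ \Gamma,B\vdash C\Rightarrow\Gamma,A\oplus B\vdash C$; $\Gamma\vdash A\Rightarrow\Gamma\vdash\forall xA$; $\Gamma,A[t/x]\vdash C\Rightarrow\Gamma,\forall xA\vdash C$; $\Gamma\vdash A[t/x]\Rightarrow\Gamma\vdash\exists xA$; $\Gamma,A\vdash C\Rightarrow\Gamma,\exists xA\vdash C$ (usual eigenvariable conditions); $\Gamma,!A,!A\vdash C\Rightarrow\Gamma,!A\vdash C$; $\Gamma\vdash C\Rightarrow\Gamma,!A\vdash C$; $!\Gamma\vdash A\Rightarrow\,!\Gamma\vdash\,!A$; $\Gamma,A\vdash C\Rightarrow\Gamma,!A\vdash C$. $\mathsf{ILL}_\bot$ extends $\mathsf{ILL}$ by one more constant $\bot$ (also counted as atomic); its sequents have at most one formula on the right (so $C$ in the rules above may be absent), and it has the additional axiom $\bot\vdash$ and rule $\Gamma\vdash\ \Rightarrow\Gamma\vdash\bot$. Negation is $\neg A:=A\multimap\bot$. $\mathsf{PRO}$ is the axiom schema $A\vdash\,!A$ and $\mathsf{DNE}$ the axiom schema $\neg\neg A\vdash A$. $\vdash_S A$ means that the sequent $\vdash A$ is derivable in $S$. $\mathsf{CL}$ is standard first-order classical logic with $\wedge,\vee,\to,\bot,\forall,\exists$. The translation $(\cdot)^\dagger$: $P^\dagger:=P$ for $P$ atomic other than $\bot$; $\bot^\dagger:=\bot$;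 $(A\wedge B)^\dagger:=A^\dagger\& B^\dagger$; $(A\vee B)^\dagger:=A^\dagger\oplus B^\dagger$; $(A\to B)^\dagger:=A^\dagger\multimap B^\dagger$; $(\forall xA)^\dagger:=\forall xA^\dagger$; $(\exists xA)^\dagger:=\exists xA^\dagger$. -}

module Defs where

open import Data.List.Base using (List; []; _∷_; [_]; _++_; map)
open import Data.List.Membership.Propositional using (_∈_)
open import Data.List.Relation.Binary.Permutation.Propositional using (_↭_)
open import Data.Maybe.Base as Maybe using (Maybe; just; nothing)
open import Data.Nat.Base using (ℕ; zero; suc)
open import Data.Vec.Base using (Vec; []; _∷_)
open import Function.Base using (_∘_)
open import Level using (0ℓ)
open import Relation.Binary.Construct.Union using (_∪_)
open import Relation.Binary.Core using (REL)

record Signature : Set₁ where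
  field
    Fun       : Set
    Pred      : Set
    funArity  : Fun → ℕ
    predArity : Pred → ℕ

module FirstOrder (𝓛 : Signature) where
  open Signature 𝓛

  -- Variables are de Bruijn indices ranging over all of ℕ (not scoped by a
  -- Fin n): as in the usual calculi, there is an unlimited supply of free
  -- variables, so that e.g. ∀xP ⊢ ∃xP is derivable without constants.

  data Term : Set where
    var : ℕ → Term
    fun : (f : Fun) → Vec Term (funArity f) → Term

  Subst : Set
  Subst = ℕ → Term

  substᵗ  : Subst → Term → Term
  substᵗˢ : ∀ {n} → Subst → Vec Term n → Vec Term n

  substᵗ σ (var x)    = σ x
  substᵗ σ (fun f ts) = fun f (substᵗˢ σ ts)

  substᵗˢ σ []       = []
  substᵗˢ σ (t ∷ ts) = substᵗ σ t ∷ substᵗˢ σ ts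

  shift : Subst
  shift = var ∘ suc

  lift : Subst → Subst
  lift σ zero    = var zero
  lift σ (suc x) = substᵗ shift (σ x)

  inst : Term → Subst
  inst t zero    = t
  inst t (suc x) = var x

  infix  30 ∀′_ ∃′_ !_
  infixr 25 _∧_ _⊗_ _&_
  infixr 24 _∨_ _⊕_
  infixr 23 _⇒_ _⊸_

  data Formula : Set where
    atom        : (P : Pred) → Vec Term (predArity P) → Formula
    ⊥           : Formula
    _∧_ _∨_ _⇒_ : Formula → Formula → Formula
    ∀′_ ∃′_     : Formula → Formula

  subst : Subst → Formula → Formula
  subst σ (atom P ts) = atom P (substᵗˢ σ ts)
  subst σ ⊥           = ⊥
  subst σ (A ∧ B)     = subst σ A ∧ subst σ B
  subst σ (A ∨ B)     = subst σ A ∨ subst σ B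
  subst σ (A ⇒ B)     = subst σ A ⇒ subst σ B
  subst σ (∀′ A)      = ∀′ subst (lift σ) A
  subst σ (∃′ A)      = ∃′ subst (lift σ) A

  -- Gentzen–Prawitz natural deduction, in sequent notation.  Here and below,
  -- shifting the side formulas frees the index 0 as the eigenvariable.

  infix 4 _⊢ᶜ_

  data _⊢ᶜ_ (Γ : List Formula) : Formula → Set where
    hyp : ∀ {A} → A ∈ Γ → Γ ⊢ᶜ A
    raa : ∀ {A} → (A ⇒ ⊥) ∷ Γ ⊢ᶜ ⊥ → Γ ⊢ᶜ A
    ∧I  : ∀ {A B} → Γ ⊢ᶜ A → Γ ⊢ᶜ B → Γ ⊢ᶜ A ∧ B
    ∧E₁ : ∀ {A B} → Γ ⊢ᶜ A ∧ B → Γ ⊢ᶜ A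
    ∧E₂ : ∀ {A B} → Γ ⊢ᶜ A ∧ B → Γ ⊢ᶜ B
    ∨I₁ : ∀ {A B} → Γ ⊢ᶜ A → Γ ⊢ᶜ A ∨ B
    ∨I₂ : ∀ {A B} → Γ ⊢ᶜ B → Γ ⊢ᶜ A ∨ B
    ∨E  : ∀ {A B C} → Γ ⊢ᶜ A ∨ B → A ∷ Γ ⊢ᶜ C → B ∷ Γ ⊢ᶜ C → Γ ⊢ᶜ C
    ⇒I  : ∀ {A B} → A ∷ Γ ⊢ᶜ B → Γ ⊢ᶜ A ⇒ B
    ⇒E  : ∀ {A B} → Γ ⊢ᶜ A ⇒ B → Γ ⊢ᶜ A → Γ ⊢ᶜ B
    ∀I  : ∀ {A} → map (subst shift) Γ ⊢ᶜ A → Γ ⊢ᶜ ∀′ A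
    ∀E  : ∀ {A} t → Γ ⊢ᶜ ∀′ A → Γ ⊢ᶜ subst (inst t) A
    ∃I  : ∀ {A} t → Γ ⊢ᶜ subst (inst t) A → Γ ⊢ᶜ ∃′ A
    ∃E  : ∀ {A C} → Γ ⊢ᶜ ∃′ A →
          A ∷ map (subst shift) Γ ⊢ᶜ subst shift C → Γ ⊢ᶜ C

  ⊢CL_ : Formula → Set
  ⊢CL A = [] ⊢ᶜ A

  data LFormula : Set where
    atom            : (P : Pred) → Vec Term (predArity P) → LFormula
    𝟏 ⊤ 𝟎 ⊥         : LFormula
    _⊗_ _&_ _⊕_ _⊸_ : LFormula → LFormula → LFormula
    ∀′_ ∃′_ !_      : LFormula → LFormula

  infix 30 ¬_

  ¬_ : LFormula → LFormula
  ¬ A = A ⊸ ⊥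

  substᴸ : Subst → LFormula → LFormula
  substᴸ σ (atom P ts) = atom P (substᵗˢ σ ts)
  substᴸ σ 𝟏           = 𝟏
  substᴸ σ ⊤           = ⊤
  substᴸ σ 𝟎           = 𝟎
  substᴸ σ ⊥           = ⊥
  substᴸ σ (A ⊗ B)     = substᴸ σ A ⊗ substᴸ σ B
  substᴸ σ (A & B)     = substᴸ σ A & substᴸ σ B
  substᴸ σ (A ⊕ B)     = substᴸ σ A ⊕ substᴸ σ B
  substᴸ σ (A ⊸ B)     = substᴸ σ A ⊸ substᴸ σ B
  substᴸ σ (∀′ A)      = ∀′ substᴸ (lift σ) A
  substᴸ σ (∃′ A)      = ∃′ substᴸ (lift σ) A
  substᴸ σ (! A)       = ! substᴸ σ A

  -- A set of sequents.  Antecedents are multisets, represented by lists with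
  -- an explicit exchange rule; succedents hold at most one formula.
  Sequents : Set₁
  Sequents = REL (List LFormula) (Maybe LFormula) 0ℓ

  -- ILL⊥+ Ax is ILL⊥ extended by the sequents in Ax as additional axioms.
  data ILL⊥+ (Ax : Sequents) : Sequents

  infix 4 ILL⊥+
  syntax ILL⊥+ Ax Γ C = Γ ⊢[ Ax ] C

  data ILL⊥+ Ax where
    axiom    : ∀ {Γ C} → Ax Γ C → Γ ⊢[ Ax ] C
    exchange : ∀ {Γ Δ C} → Γ ↭ Δ → Γ ⊢[ Ax ] C → Δ ⊢[ Ax ] C
    id       : ∀ {A} → [ A ] ⊢[ Ax ] just A
    cut      : ∀ {Γ Δ A C} →
               Γ ⊢[ Ax ] just A → A ∷ Δ ⊢[ Ax ] C → Γ ++ Δ ⊢[ Ax ] C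
    𝟏R       : [] ⊢[ Ax ] just 𝟏
    𝟏L       : ∀ {Γ C} → Γ ⊢[ Ax ] C → 𝟏 ∷ Γ ⊢[ Ax ] C
    ⊤R       : ∀ {Γ} → Γ ⊢[ Ax ] just ⊤
    𝟎L       : ∀ {Γ C} → 𝟎 ∷ Γ ⊢[ Ax ] C
    ⊥L       : [ ⊥ ] ⊢[ Ax ] nothing
    ⊥R       : ∀ {Γ} → Γ ⊢[ Ax ] nothing → Γ ⊢[ Ax ] just ⊥
    ⊗R       : ∀ {Γ Δ A B} →
               Γ ⊢[ Ax ] just A → Δ ⊢[ Ax ] just B → Γ ++ Δ ⊢[ Ax ] just (A ⊗ B)
    ⊗L       : ∀ {Γ A B C} → A ∷ B ∷ Γ ⊢[ Ax ] C → A ⊗ B ∷ Γ ⊢[ Ax ] C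
    ⊸R       : ∀ {Γ A B} → A ∷ Γ ⊢[ Ax ] just B → Γ ⊢[ Ax ] just (A ⊸ B)
    ⊸L       : ∀ {Γ Δ A B C} →
               Γ ⊢[ Ax ] just A → B ∷ Δ ⊢[ Ax ] C → A ⊸ B ∷ Γ ++ Δ ⊢[ Ax ] C
    &R       : ∀ {Γ A B} →
               Γ ⊢[ Ax ] just A → Γ ⊢[ Ax ] just B → Γ ⊢[ Ax ] just (A & B)
    &L₁      : ∀ {Γ A B C} → A ∷ Γ ⊢[ Ax ] C → A & B ∷ Γ ⊢[ Ax ] C
    &L₂      : ∀ {Γ A B C} → B ∷ Γ ⊢[ Ax ] C → A & B ∷ Γ ⊢[ Ax ] C
    ⊕R₁      : ∀ {Γ A B} → Γ ⊢[ Ax ] just A → Γ ⊢[ Ax ] just (A ⊕ B)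
    ⊕R₂      : ∀ {Γ A B} → Γ ⊢[ Ax ] just B → Γ ⊢[ Ax ] just (A ⊕ B)
    ⊕L       : ∀ {Γ A B C} →
               A ∷ Γ ⊢[ Ax ] C → B ∷ Γ ⊢[ Ax ] C → A ⊕ B ∷ Γ ⊢[ Ax ] C
    ∀R       : ∀ {Γ A} →
               map (substᴸ shift) Γ ⊢[ Ax ] just A → Γ ⊢[ Ax ] just (∀′ A)
    ∀L       : ∀ {Γ A C} t → substᴸ (inst t) A ∷ Γ ⊢[ Ax ] C → ∀′ A ∷ Γ ⊢[ Ax ] C
    ∃R       : ∀ {Γ A} t → Γ ⊢[ Ax ] just (substᴸ (inst t) A) → Γ ⊢[ Ax ] just (∃′ A)
    ∃L       : ∀ {Γ A C} →
               A ∷ map (substᴸ shift) Γ ⊢[ Ax ] Maybe.map (substᴸ shift) C →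
               ∃′ A ∷ Γ ⊢[ Ax ] C
    !C       : ∀ {Γ A C} → ! A ∷ ! A ∷ Γ ⊢[ Ax ] C → ! A ∷ Γ ⊢[ Ax ] C
    !W       : ∀ {Γ A C} → Γ ⊢[ Ax ] C → ! A ∷ Γ ⊢[ Ax ] C
    !R       : ∀ {Γ A} → map !_ Γ ⊢[ Ax ] just A → map !_ Γ ⊢[ Ax ] just (! A)
    !L       : ∀ {Γ A C} → A ∷ Γ ⊢[ Ax ] C → ! A ∷ Γ ⊢[ Ax ] C

  data PRO : Sequents where
    pro : ∀ A → PRO [ A ] (just (! A))

  data DNE : Sequents where
    dne : ∀ A → DNE [ ¬ ¬ A ] (just A)

  CLb : Sequents
  CLb = ILL⊥+ (PRO ∪ DNE)

  ⊢CLb_ : LFormula → Set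
  ⊢CLb A = CLb [] (just A)

  infix 4 ⊢CL_ ⊢CLb_
  infix 31 _†

  _† : Formula → LFormula
  atom P ts † = atom P ts
  ⊥ †         = ⊥
  (A ∧ B) †   = A † & B †
  (A ∨ B) †   = A † ⊕ B †
  (A ⇒ B) †   = A † ⊸ B †
  (∀′ A) †    = ∀′ A †
  (∃′ A) †    = ∃′ A †

{-# OPTIONS --safe #-}

-- PRO makes weakening and contraction available for every formula (cut with
-- A ⊢ !A), and DNE gives reductio ad absurdum; so the additive translation of
-- natural deduction goes through.  Conversely, erasing the linear structure
-- (⊗ and & to ∧, ⊕ to ∨, ⊸ to ⇒, ! to nothing) turns all rules of CLb into
-- classically valid ones, and erasure is a left inverse of the translation.

module Submission where

open import Data.List.Base using ([]; _∷_; [_]; _++_; map)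
open import Data.List.Membership.Propositional using (_∈_)
open import Data.List.Properties using (map-∘; map-cong; ++-identityʳ)
open import Data.List.Relation.Binary.Permutation.Propositional using (_↭_; ↭-refl; ↭-sym; ↭-trans; prep; swap)
open import Data.List.Relation.Binary.Permutation.Propositional.Properties as Perm using (∈-resp-↭; ++-comm)
open import Data.List.Relation.Binary.Subset.Propositional using (_⊆_)
open import Data.List.Relation.Binary.Subset.Propositional.Properties as Subset using (xs⊆x∷xs; ∷⁺ʳ; xs⊆xs++ys; xs⊆ys++xs)
open import Data.List.Relation.Unary.Any using (here; there)
open import Data.Maybe.Base as Maybe using (Maybe; just; nothing)
open import Data.Sum.Base using (inj₁; inj₂)
open import Defs
open import Function.Bundles using (_⇔_; mk⇔)
open import Relation.Binary.PropositionalEquality using (_≡_; refl; sym; trans; cong; cong₂; subst₂)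
import Relation.Binary.PropositionalEquality as ≡

module Equivalence (𝓛 : Signature) where
  open FirstOrder 𝓛

  map-commute : ∀ {A B : Set} {f : A → B} {g : A → A} {h : B → B} →
                (∀ x → f (g x) ≡ h (f x)) →
                ∀ xs → map f (map g xs) ≡ map h (map f xs)
  map-commute eq xs = trans (sym (map-∘ xs)) (trans (map-cong eq xs) (map-∘ xs))

  -- The quantifier rules need this: instances by `inst t` and contexts renamed by `shift` must
  -- agree on both sides.
  subst-† : ∀ σ A → subst σ A † ≡ substᴸ σ (A †)
  subst-† σ (atom P ts) = refl
  subst-† σ ⊥           = refl
  subst-† σ (A ∧ B)     = cong₂ _&_ (subst-† σ A) (subst-† σ B)
  subst-† σ (A ∨ B)     = cong₂ _⊕_ (subst-† σ A) (subst-† σ B)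
  subst-† σ (A ⇒ B)     = cong₂ _⊸_ (subst-† σ A) (subst-† σ B)
  subst-† σ (∀′ A)      = cong ∀′_ (subst-† (lift σ) A)
  subst-† σ (∃′ A)      = cong ∃′_ (subst-† (lift σ) A)

  map-subst-† : ∀ σ Γ → map _† (map (subst σ) Γ) ≡ map (substᴸ σ) (map _† Γ)
  map-subst-† σ = map-commute (subst-† σ)

  wkL : ∀ {Γ C} A → CLb Γ C → CLb (A ∷ Γ) C
  wkL A d = cut (axiom (inj₁ (pro A))) (!W d)

  contrL : ∀ {Γ A C} → CLb (A ∷ A ∷ Γ) C → CLb (A ∷ Γ) C
  contrL {A = A} d =
    cut (axiom (inj₁ (pro A)))
        -- Contraction is done on `! A`; dereliction then turns each copy back into `A`, with a swap
        -- because `!L` acts on the head.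
        (!C (!L (exchange (swap _ _ ↭-refl) (!L d))))

  wkL* : ∀ {C} A Γ → CLb [ A ] C → CLb (A ∷ Γ) C
  wkL* A []      d = d
  wkL* A (B ∷ Γ) d = exchange (swap _ _ ↭-refl) (wkL B (wkL* A Γ d))

  -- Induction on `Γ`: the two copies of its head are brought together and contracted, and the
  -- remaining one is parked in `Δ`, which therefore has to vary.
  contrL* : ∀ {C} Γ Δ → CLb (Γ ++ Γ ++ Δ) C → CLb (Γ ++ Δ) C
  contrL* []      Δ d = d
  contrL* (A ∷ Γ) Δ d =
    exchange (Perm.shift A Γ Δ)
      (contrL* Γ (A ∷ Δ)
        (exchange (↭-sym toMiddle)
          (contrL (exchange (prep A (Perm.shift A Γ (Γ ++ Δ))) d))))
    where
    toMiddle : Γ ++ Γ ++ A ∷ Δ ↭ A ∷ Γ ++ Γ ++ Δ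
    toMiddle = ↭-trans (Perm.++⁺ˡ Γ (Perm.shift A Γ Δ)) (Perm.shift A Γ (Γ ++ Δ))

  -- Natural deduction shares one context among its premises, whereas `cut` concatenates contexts.
  -- Contracting `Γ ++ Γ` bridges the gap, and each elimination rule becomes such a cut against a
  -- left rule.
  cut-shared : ∀ {Γ A C} → CLb Γ (just A) → CLb (A ∷ Γ) C → CLb Γ C
  cut-shared {Γ} {C = C} d e =
    ≡.subst (λ Δ → CLb Δ C) (++-identityʳ Γ)
      (contrL* Γ [] (≡.subst (λ Δ → CLb (Γ ++ Δ) C) (sym (++-identityʳ Γ)) (cut d e)))

  hypL : ∀ {A Γ} → A ∈ Γ → CLb (map _† Γ) (just (A †))
  hypL (here {xs = Γ} refl) = wkL* _ (map _† Γ) id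
  hypL (there i)            = wkL _ (hypL i)

  CL⇒CLb : ∀ {Γ A} → Γ ⊢ᶜ A → CLb (map _† Γ) (just (A †))
  CL⇒CLb (hyp i) = hypL i
  CL⇒CLb {A = A} (raa d) =
    -- `(A ⇒ ⊥) †` computes to `¬ (A †)`, so `⊸R` yields the double negation.
    cut-shared (⊸R (CL⇒CLb d)) (wkL* _ _ (axiom (inj₂ (dne (A †)))))
  CL⇒CLb (∧I d e) = &R (CL⇒CLb d) (CL⇒CLb e)
  CL⇒CLb (∧E₁ d) = cut-shared (CL⇒CLb d) (wkL* _ _ (&L₁ id))
  CL⇒CLb (∧E₂ d) = cut-shared (CL⇒CLb d) (wkL* _ _ (&L₂ id))
  CL⇒CLb (∨I₁ d) = ⊕R₁ (CL⇒CLb d)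
  CL⇒CLb (∨I₂ d) = ⊕R₂ (CL⇒CLb d)
  CL⇒CLb (∨E d e f) = cut-shared (CL⇒CLb d) (⊕L (CL⇒CLb e) (CL⇒CLb f))
  CL⇒CLb (⇒I d) = ⊸R (CL⇒CLb d)
  CL⇒CLb {Γ} (⇒E d e) =
    cut-shared (CL⇒CLb d)
      -- `⊸L` is used with `id` on the right, which leaves a trailing `++ []` to be removed.
      (exchange (prep _ (++-comm (map _† Γ) []))
        (⊸L (CL⇒CLb e) id))
  CL⇒CLb {Γ} (∀I {A} d) =
    ∀R (≡.subst (λ Δ → CLb Δ (just (A †))) (map-subst-† shift Γ) (CL⇒CLb d))
  CL⇒CLb (∀E {A} t d) =
    cut-shared (CL⇒CLb d)
      (wkL* _ _ (∀L t
        (≡.subst (λ B → CLb [ substᴸ (inst t) (A †) ] (just B))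
                 (sym (subst-† (inst t) A)) id)))
  CL⇒CLb {Γ} (∃I {A} t d) =
    ∃R t (≡.subst (λ B → CLb (map _† Γ) (just B)) (subst-† (inst t) A) (CL⇒CLb d))
  CL⇒CLb {Γ} (∃E {A} {C} d e) =
    cut-shared (CL⇒CLb d)
      (∃L (subst₂ (λ Δ B → CLb (A † ∷ Δ) (just B))
                  (map-subst-† shift Γ) (subst-† shift C) (CL⇒CLb e)))

  infix 31 _°

  -- Classical formulas have no constant for truth; `⊥ ⇒ ⊥` serves instead.
  _° : LFormula → Formula
  atom P ts ° = atom P ts
  𝟏 °         = ⊥ ⇒ ⊥
  ⊤ °         = ⊥ ⇒ ⊥
  𝟎 °         = ⊥
  ⊥ °         = ⊥
  (A ⊗ B) °   = A ° ∧ B °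
  (A & B) °   = A ° ∧ B °
  (A ⊕ B) °   = A ° ∨ B °
  (A ⊸ B) °   = A ° ⇒ B °
  (∀′ A) °    = ∀′ A °
  (∃′ A) °    = ∃′ A °
  (! A) °     = A °

  †-° : ∀ A → A † ° ≡ A
  †-° (atom P ts) = refl
  †-° ⊥           = refl
  †-° (A ∧ B)     = cong₂ _∧_ (†-° A) (†-° B)
  †-° (A ∨ B)     = cong₂ _∨_ (†-° A) (†-° B)
  †-° (A ⇒ B)     = cong₂ _⇒_ (†-° A) (†-° B)
  †-° (∀′ A)      = cong ∀′_ (†-° A)
  †-° (∃′ A)      = cong ∃′_ (†-° A)

  subst-° : ∀ σ A → substᴸ σ A ° ≡ subst σ (A °)
  subst-° σ (atom P ts) = refl
  subst-° σ 𝟏           = refl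
  subst-° σ ⊤           = refl
  subst-° σ 𝟎           = refl
  subst-° σ ⊥           = refl
  subst-° σ (A ⊗ B)     = cong₂ _∧_ (subst-° σ A) (subst-° σ B)
  subst-° σ (A & B)     = cong₂ _∧_ (subst-° σ A) (subst-° σ B)
  subst-° σ (A ⊕ B)     = cong₂ _∨_ (subst-° σ A) (subst-° σ B)
  subst-° σ (A ⊸ B)     = cong₂ _⇒_ (subst-° σ A) (subst-° σ B)
  subst-° σ (∀′ A)      = cong ∀′_ (subst-° (lift σ) A)
  subst-° σ (∃′ A)      = cong ∃′_ (subst-° (lift σ) A)
  subst-° σ (! A)       = subst-° σ A

  map-subst-° : ∀ σ Γ → map _° (map (substᴸ σ) Γ) ≡ map (subst σ) (map _° Γ)
  map-subst-° σ = map-commute (subst-° σ)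

  -- Reading an empty succedent as falsity makes `⊥L` an identity and lets `⊥R` keep its premise.
  succ° : Maybe LFormula → Formula
  succ° (just A) = A °
  succ° nothing  = ⊥

  subst-succ° : ∀ σ C → succ° (Maybe.map (substᴸ σ) C) ≡ subst σ (succ° C)
  subst-succ° σ (just A) = subst-° σ A
  subst-succ° σ nothing  = refl

  -- Working with inclusion covers exchange as well as weakening.
  weaken : ∀ {Γ Δ A} → Γ ⊆ Δ → Γ ⊢ᶜ A → Δ ⊢ᶜ A
  weaken s (hyp i)    = hyp (s i)
  weaken s (raa d)    = raa (weaken (∷⁺ʳ _ s) d)
  weaken s (∧I d e)   = ∧I (weaken s d) (weaken s e)
  weaken s (∧E₁ d)    = ∧E₁ (weaken s d)
  weaken s (∧E₂ d)    = ∧E₂ (weaken s d)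
  weaken s (∨I₁ d)    = ∨I₁ (weaken s d)
  weaken s (∨I₂ d)    = ∨I₂ (weaken s d)
  weaken s (∨E d e f) = ∨E (weaken s d) (weaken (∷⁺ʳ _ s) e) (weaken (∷⁺ʳ _ s) f)
  weaken s (⇒I d)     = ⇒I (weaken (∷⁺ʳ _ s) d)
  weaken s (⇒E d e)   = ⇒E (weaken s d) (weaken s e)
  weaken s (∀I d)     = ∀I (weaken (Subset.map⁺ _ s) d)
  weaken s (∀E t d)   = ∀E t (weaken s d)
  weaken s (∃I t d)   = ∃I t (weaken s d)
  weaken s (∃E d e)   = ∃E (weaken s d) (weaken (∷⁺ʳ _ (Subset.map⁺ _ s)) e)

  -- Cut as a detour through `⇒`, which avoids substituting derivations into one another.
  let-in : ∀ {Γ A B} → Γ ⊢ᶜ A → A ∷ Γ ⊢ᶜ B → Γ ⊢ᶜ B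
  let-in d e = ⇒E (⇒I e) d

  exfalso : ∀ {Γ A} → Γ ⊢ᶜ ⊥ → Γ ⊢ᶜ A
  exfalso d = raa (weaken (xs⊆x∷xs _ _) d)

  -- Simulates a left rule with principal formula `A` and active formula `B`.
  replace-head : ∀ {Γ A B C} → A ∷ Γ ⊢ᶜ B → B ∷ Γ ⊢ᶜ C → A ∷ Γ ⊢ᶜ C
  replace-head d e = let-in d (weaken (∷⁺ʳ _ (xs⊆x∷xs _ _)) e)

  map-++ˡ : ∀ {A} Γ Δ → map _° Γ ⊢ᶜ A → map _° (Γ ++ Δ) ⊢ᶜ A
  map-++ˡ Γ Δ = weaken (Subset.map⁺ _ (xs⊆xs++ys Γ Δ))

  map-++ʳ : ∀ {A} Γ Δ → map _° Δ ⊢ᶜ A → map _° (Γ ++ Δ) ⊢ᶜ A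
  map-++ʳ Γ Δ = weaken (Subset.map⁺ _ (xs⊆ys++xs Δ Γ))

  CLb⇒CL : ∀ {Γ C} → CLb Γ C → map _° Γ ⊢ᶜ succ° C
  CLb⇒CL (axiom (inj₁ (pro A))) = hyp (here refl)
  CLb⇒CL (axiom (inj₂ (dne A))) = raa (⇒E (hyp (there (here refl))) (hyp (here refl)))
  CLb⇒CL (exchange p d) = weaken (Subset.map⁺ _ (∈-resp-↭ p)) (CLb⇒CL d)
  CLb⇒CL id = hyp (here refl)
  CLb⇒CL (cut {Γ} {Δ} d e) =
    let-in (map-++ˡ Γ Δ (CLb⇒CL d))
           (weaken (∷⁺ʳ _ (Subset.map⁺ _ (xs⊆ys++xs Δ Γ))) (CLb⇒CL e))
  CLb⇒CL 𝟏R = ⇒I (hyp (here refl))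
  CLb⇒CL (𝟏L d) = weaken (xs⊆x∷xs _ _) (CLb⇒CL d)
  CLb⇒CL ⊤R = ⇒I (hyp (here refl))
  CLb⇒CL 𝟎L = exfalso (hyp (here refl))
  CLb⇒CL ⊥L = hyp (here refl)
  CLb⇒CL (⊥R d) = CLb⇒CL d
  CLb⇒CL (⊗R {Γ} {Δ} d e) = ∧I (map-++ˡ Γ Δ (CLb⇒CL d)) (map-++ʳ Γ Δ (CLb⇒CL e))
  CLb⇒CL (⊗L d) =
    -- The second conjunct is added first, so that the first one ends up at the head as in the
    -- premise.
    let-in (∧E₂ (hyp (here refl)))
      (let-in (∧E₁ (hyp (there (here refl))))
        (weaken (∷⁺ʳ _ (∷⁺ʳ _ (xs⊆x∷xs _ _))) (CLb⇒CL d)))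
  CLb⇒CL (⊸R d) = ⇒I (CLb⇒CL d)
  CLb⇒CL (⊸L {Γ} {Δ} d e) =
    replace-head
      (⇒E (hyp (here refl)) (weaken (xs⊆x∷xs _ _) (map-++ˡ Γ Δ (CLb⇒CL d))))
      (weaken (∷⁺ʳ _ (Subset.map⁺ _ (xs⊆ys++xs Δ Γ))) (CLb⇒CL e))
  CLb⇒CL (&R d e) = ∧I (CLb⇒CL d) (CLb⇒CL e)
  CLb⇒CL (&L₁ d) = replace-head (∧E₁ (hyp (here refl))) (CLb⇒CL d)
  CLb⇒CL (&L₂ d) = replace-head (∧E₂ (hyp (here refl))) (CLb⇒CL d)
  CLb⇒CL (⊕R₁ d) = ∨I₁ (CLb⇒CL d)
  CLb⇒CL (⊕R₂ d) = ∨I₂ (CLb⇒CL d)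
  CLb⇒CL (⊕L d e) =
    ∨E (hyp (here refl))
       (weaken (∷⁺ʳ _ (xs⊆x∷xs _ _)) (CLb⇒CL d))
       (weaken (∷⁺ʳ _ (xs⊆x∷xs _ _)) (CLb⇒CL e))
  CLb⇒CL (∀R {Γ} {A} d) =
    ∀I (≡.subst (λ Δ → Δ ⊢ᶜ A °) (map-subst-° shift Γ) (CLb⇒CL d))
  CLb⇒CL (∀L {Γ} {A} {C} t d) =
    replace-head (∀E t (hyp (here refl)))
      (≡.subst (λ B → B ∷ map _° Γ ⊢ᶜ succ° C) (subst-° (inst t) A) (CLb⇒CL d))
  CLb⇒CL (∃R {Γ} {A} t d) =
    ∃I t (≡.subst (λ B → map _° Γ ⊢ᶜ B) (subst-° (inst t) A) (CLb⇒CL d))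
  CLb⇒CL (∃L {Γ} {A} {C} d) =
    ∃E (hyp (here refl))
      (weaken (∷⁺ʳ _ (xs⊆x∷xs _ _))
        (subst₂ (λ Δ B → A ° ∷ Δ ⊢ᶜ B)
                (map-subst-° shift Γ) (subst-succ° shift C) (CLb⇒CL d)))
  -- Cutting with a hypothesis already present is contraction.
  CLb⇒CL (!C d) = let-in (hyp (here refl)) (CLb⇒CL d)
  CLb⇒CL (!W d) = weaken (xs⊆x∷xs _ _) (CLb⇒CL d)
  -- `! A` and `A` have the same erasure by computation, so promotion and dereliction leave the
  -- erased sequent unchanged.
  CLb⇒CL (!R d) = CLb⇒CL d
  CLb⇒CL (!L d) = CLb⇒CL d

proposition3 : (𝓛 : Signature) → let open FirstOrder 𝓛 in
    (A : Formula) → (⊢CL A) ⇔ (⊢CLb A †)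
proposition3 𝓛 A = mk⇔ CL⇒CLb (λ d → ≡.subst (λ B → ⊢CL B) (†-° A) (CLb⇒CL d))
  where
  open FirstOrder 𝓛
  open Equivalence 𝓛
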